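{- $\mathrm{L}^{\circlearrowleft}$-grammars recognize all permutations of regular languages: for every finite alphabet $\Sigma$ and every regular language $L\subseteq\Sigma^+$ (i.e. not containing the empty word), there exists an $\mathrm{L}^{\circlearrowleft}$-grammar $G$ over $\Sigma$ such that $L(G)=\mathrm{PERM}(L)$, where $\mathrm{PERM}(L)=\{a_{\sigma(1)}\dots a_{\sigma(n)}\mid a_1\dots a_n\in L,\ \sigma\in S_n\}$.
   Context: Types are built from primitive types (elements of a fixed countably infinite set $Pr$) using the binary connectives $\backslash$, $/$, $\cdot$ and a unary connective $A\mapsto A^{\circlearrowleft}$; the set of all types is $Tp^{\circlearrowleft}$. A sequent is $A_1,\dots,A_n\to B$ with $n\ge 1$ and $A_i,B$ types. Capital Latin letters denote types, $\Gamma,\Delta$ finite (possibly empty) sequences of types, $\Pi,\Psi$ nonempty finite sequences of types. Axioms and rules of $\mathrm{L}^{\circlearrowleft}$: - $(\mathrm{Ax})$: $A\to A$. - $(\backslash\to)$: from $\Gamma,B,\Delta\to C$ and $\Pi\to A$ infer $\Gamma,\Pi,A\backslash B,\Delta\to C$. - $(\to\backslash)$: from $A,\Pi\to B$ infer $\Pi\to A\backslash B$. - $(/\to)$: from $\Gamma,B,\Delta\to C$ and $\Pi\to A$ infer $\Gamma,B/A,\Pi,\Delta\to C$. - $(\to/)$: from $\Pi,A\to B$ infer $\Pi\to B/A$. - $(\cdot\to)$: from $\Gamma,A,B,\Delta\to C$ infer $\Gamma,A\cdot B,\Delta\to C$. - $(\to\cdot)$: from $\Pi\to A$ and $\Psi\to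 B$ infer $\Pi,\Psi\to A\cdot B$. - $(\mathrm{cut})$: from $\Pi\to A$ and $\Gamma,A,\Delta\to B$ infer $\Gamma,\Pi,\Delta\to B$. - $(\to^{\circlearrowleft})$: from $\Pi\to A$ infer $\Pi\to A^{\circlearrowleft}$. - $(^{\circlearrowleft}\to)$: from $B\to A^{\circlearrowleft}$ infer $B^{\circlearrowleft}\to A^{\circlearrowleft}$. - $(\circlearrowleft)$: from $\Pi,\Psi\to A^{\circlearrowleft}$ infer $\Psi,\Pi\to A^{\circlearrowleft}$. An $\mathrm{L}^{\circlearrowleft}$-grammar is a triple $G=\langle\Sigma,T,\triangleright\rangle$ where $\Sigma$ is a finite alphabet, $T\in Tp^{\circlearrowleft}$ is a distinguished type, and $\triangleright\subseteq\Sigma\times Tp^{\circlearrowleft}$ is a finite binary relation. The language recognized by $G$ is $L(G)=\{a_1\dots a_n\in\Sigma^+\mid \exists\,T_1,\dots,T_n\in Tp^{\circlearrowleft}:\ a_i\triangleright T_i\text{ for } i=1,\dots,n,\text{ and } \mathrm{L}^{\circlearrowleft}\vdash T_1,\dots,T_n\to T\}$. -}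

module Defs where

open import Data.Bool using (Bool; T)
open import Data.Fin using (Fin)
open import Data.Fin.Permutation using (Permutation′; _⟨$⟩ʳ_)
open import Data.List using (List; []; [_]; _++_; length; lookup; tabulate; foldl)
open import Data.List.Membership.Propositional using (_∈_)
open import Data.List.NonEmpty using (List⁺; toList)
open import Data.List.Relation.Binary.Pointwise using (Pointwise)
open import Data.Nat using (ℕ)
open import Data.Product using (_×_; _,_; ∃-syntax; Σ-syntax)
open import Function using (_↔_)
open import Level using (0ℓ)
open import Relation.Binary.PropositionalEquality using (_≡_; _≢_)
open import Relation.Unary using (Pred; _≐_)

Pr : Set
Pr = ℕ

infixr 30 _∖_
infixl 30 _/_
infixl 35 _·_
infix  40 _↻

data Tp : Set where
  prim : Pr → Tp
  _∖_  : Tp → Tp → Tp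
  _/_  : Tp → Tp → Tp
  _·_  : Tp → Tp → Tp
  _↻   : Tp → Tp

infix 4 _⟶_

-- L↻ ⊢ A₁,…,Aₙ → B.  Π and Ψ range over nonempty sequences, so every
-- derivable sequent has n ≥ 1 although the index is an arbitrary list.
data _⟶_ : List Tp → Tp → Set where
  Ax  : ∀ {A} → [ A ] ⟶ A
  ∖⟶  : ∀ {A B C} (Γ : List Tp) (Π : List⁺ Tp) (Δ : List Tp) →
        Γ ++ [ B ] ++ Δ ⟶ C → toList Π ⟶ A →
        Γ ++ toList Π ++ [ A ∖ B ] ++ Δ ⟶ C
  ⟶∖  : ∀ {A B} (Π : List⁺ Tp) →
        [ A ] ++ toList Π ⟶ B →
        toList Π ⟶ A ∖ B
  /⟶  : ∀ {A B C} (Γ : List Tp) (Π : List⁺ Tp) (Δ : List Tp) →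
        Γ ++ [ B ] ++ Δ ⟶ C → toList Π ⟶ A →
        Γ ++ [ B / A ] ++ toList Π ++ Δ ⟶ C
  ⟶/  : ∀ {A B} (Π : List⁺ Tp) →
        toList Π ++ [ A ] ⟶ B →
        toList Π ⟶ B / A
  ·⟶  : ∀ {A B C} (Γ Δ : List Tp) →
        Γ ++ [ A ] ++ [ B ] ++ Δ ⟶ C →
        Γ ++ [ A · B ] ++ Δ ⟶ C
  ⟶·  : ∀ {A B} (Π Ψ : List⁺ Tp) →
        toList Π ⟶ A → toList Ψ ⟶ B →
        toList Π ++ toList Ψ ⟶ A · B
  cut : ∀ {A B} (Γ : List Tp) (Π : List⁺ Tp) (Δ : List Tp) →
        toList Π ⟶ A → Γ ++ [ A ] ++ Δ ⟶ B →
        Γ ++ toList Π ++ Δ ⟶ B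
  ⟶↻  : ∀ {A} (Π : List⁺ Tp) →
        toList Π ⟶ A →
        toList Π ⟶ A ↻
  ↻⟶  : ∀ {A B} →
        [ B ] ⟶ A ↻ →
        [ B ↻ ] ⟶ A ↻
  cyc : ∀ {A} (Π Ψ : List⁺ Tp) →
        toList Π ++ toList Ψ ⟶ A ↻ →
        toList Ψ ++ toList Π ⟶ A ↻

Finite : Set → Set
Finite A = ∃[ n ] (A ↔ Fin n)

Language : Set → Set₁
Language A = Pred (List A) 0ℓ

-- The finite relation ▷ is given by the list of its pairs.
record Grammar (A : Set) : Set where
  field
    target  : Tp
    lexicon : List (A × Tp)

  _▷_ : A → Tp → Set
  a ▷ B = (a , B) ∈ lexicon

L⟨_⟩ : ∀ {A} → Grammar A → Language A
L⟨ G ⟩ w = w ≢ [] × ∃[ Ts ] (Pointwise _▷_ w Ts × Ts ⟶ target)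
  where open Grammar G

record DFA (A : Set) : Set where
  field
    states : ℕ
    start  : Fin states
    δ      : Fin states → A → Fin states
    accept : Fin states → Bool

  Accepts : Language A
  Accepts w = T (accept (foldl δ start w))

Regular : ∀ {A} → Language A → Set
Regular {A} L = Σ[ M ∈ DFA A ] L ≐ DFA.Accepts M

PERM : ∀ {A} → Language A → Language A
PERM L w = ∃[ v ] (L v × Σ[ σ ∈ Permutation′ (length v) ]
                          w ≡ tabulate (λ i → lookup v (σ ⟨$⟩ʳ i)))

{-# OPTIONS --safe #-}
-- Name each state q by a primitive type p_q and acceptance by one more, p₀; let every
-- letter a have the types p_{δ(q,a)}↻ / p_q↻ (and p₀↻ / p_q↻ if δ(q,a) accepts), besides
-- p_{δ(s,a)}↻ (and p₀↻) for the start state s.  If Γ,Δ → p_q↻, then Δ,Γ → p_q↻ by rotation,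
-- so p_r↻ / p_q↻, Δ, Γ → p_r↻, and a second rotation gives Γ, p_r↻ / p_q↻, Δ → p_r↻: the
-- last letter of a run may be inserted at any position, which yields all permutations.
-- Conversely, reading types as permutation-closed languages and A↻ as A is sound, and
-- under this reading a derivation exhibits a run on some rearrangement of the word.

module Submission where

open import Defs
open import Data.Bool using (T; true; if_then_else_)
open import Data.Fin using (Fin; zero; suc; toℕ; punchIn)
open import Data.Fin.Permutation using (Permutation; Permutation′; _⟨$⟩ʳ_; remove; punchIn-permute; ↔⇒≡)
open import Data.Fin.Properties using (toℕ-injective)
open import Data.List using (List; []; _∷_; [_]; _++_; _∷ʳ_; map; concatMap; foldl; lookup; tabulate; allFin)
open import Data.List.Membership.Propositional using (_∈_; lose; find)
open import Data.List.Membership.Propositional.Properties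
  using (∈-∃++; ∈-map⁺; ∈-map⁻; ∈-++⁺ˡ; ∈-++⁺ʳ; ∈-++⁻; ∈-concatMap⁺; ∈-concatMap⁻; ∈-allFin; ∈-insert)
open import Data.List.NonEmpty using (_∷_)
open import Data.List.Properties
  using (++-identityʳ; ++-assoc; foldl-∷ʳ; tabulate-cong; tabulate-lookup; ++-conicalˡ)
open import Data.List.Relation.Binary.Permutation.Homogeneous using (onIndices)
open import Data.List.Relation.Binary.Permutation.Propositional
  using (_↭_; prep; swap; ↭-refl; ↭-sym; ↭-trans; ↭-reflexive; ↭⇒↭ₛ)
open import Data.List.Relation.Binary.Permutation.Propositional.Properties
  using (++⁺ˡ; ++⁺ʳ; ++-comm; shifts; ∈-resp-↭; drop-mid; ↭-empty-inv)
import Data.List.Relation.Binary.Permutation.Setoid.Properties as ↭ₛ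
import Data.List.Relation.Binary.Pointwise as Pointwise
open Pointwise using (Pointwise; []; _∷_)
open import Data.List.Relation.Unary.Any using (here; there)
open import Data.List.Reverse using (Reverse; []; _∶_∶ʳ_; reverseView)
open import Data.Nat using (suc)
open import Data.Nat.Properties using (suc-injective)
open import Data.Product using (Σ-syntax; ∃-syntax; _×_; _,_; proj₁; proj₂)
open import Data.Sum using (inj₁; inj₂)
open import Function using (_∘_; Inverse)
open import Relation.Binary.PropositionalEquality
  using (_≡_; _≢_; refl; sym; trans; cong; subst; setoid)
open import Relation.Nullary using (¬_; contradiction)
open import Relation.Unary using (_≐_)

-- Rearrangements and splittings of lists.

module _ {A : Set} where

  ↭-resp-≢[] : ∀ {v w : List A} → w ↭ v → v ≢ [] → w ≢ []
  ↭-resp-≢[] w↭v v≢[] refl = v≢[] (↭-empty-inv (↭-sym w↭v))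

  -- Finds where the last letter of a run sits in a rearranged word, so that `derivable` can recurse
  -- on the rest.
  ↭-∷ʳ-inv : ∀ {w : List A} v {a} → w ↭ v ∷ʳ a →
             ∃[ x ] ∃[ y ] (w ≡ x ++ [ a ] ++ y × x ++ y ↭ v)
  ↭-∷ʳ-inv v w↭va with x , y , refl ← ∈-∃++ (∈-resp-↭ (↭-sym w↭va) (∈-insert v)) =
    x , y , refl , ↭-trans (drop-mid x v w↭va) (↭-reflexive (++-identityʳ v))

  tabulate-punchIn : ∀ {n} (f : Fin (suc n) → A) i →
                     f i ∷ tabulate (f ∘ punchIn i) ↭ tabulate f
  tabulate-punchIn f zero = ↭-refl
  tabulate-punchIn {suc n} f (suc i) =
    ↭-trans (swap _ _ ↭-refl) (prep _ (tabulate-punchIn (f ∘ suc) i))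

  tabulate-permute : ∀ {m n} (π : Permutation m n) (f : Fin n → A) →
                     tabulate (f ∘ (π ⟨$⟩ʳ_)) ↭ tabulate f
  tabulate-permute {m} {n} π f with refl ← ↔⇒≡ π = go m π f
    where
    go : ∀ n (π : Permutation′ n) (f : Fin n → A) →
         tabulate (f ∘ (π ⟨$⟩ʳ_)) ↭ tabulate f
    go 0       π f = ↭-refl
    -- Detach the image of index `zero`: `remove zero π` permutes the indices that `punchIn` leaves,
    -- and `tabulate-punchIn` puts the detached entry back in its place.
    go (suc n) π f = ↭-trans
      (prep _ (↭-trans
        (↭-reflexive (tabulate-cong (cong f ∘ punchIn-permute π zero)))
        (go n (remove zero π) (f ∘ punchIn (π ⟨$⟩ʳ zero)))))
      (tabulate-punchIn f (π ⟨$⟩ʳ zero))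

  -- `onIndices` relates the indices of two words, while `PERM` asks for a self-permutation. The
  -- lengths are variables here, so that their equality can be matched with `refl`.
  tabulate-reindex : ∀ {m n} (π : Permutation m n) {f : Fin m → A} {g : Fin n → A} →
                     (∀ i → f i ≡ g (π ⟨$⟩ʳ i)) →
                     Σ[ σ ∈ Permutation′ n ] tabulate f ≡ tabulate (g ∘ (σ ⟨$⟩ʳ_))
  tabulate-reindex π f≗g∘π with refl ← ↔⇒≡ π = π , tabulate-cong f≗g∘π

  PERM⁺ : ∀ {L : Language A} {v w} → L v → w ↭ v → PERM L w
  PERM⁺ {v = v} {w} v∈L w↭v =
    let w↭ₛv = ↭⇒↭ₛ w↭v
        σ , eq = tabulate-reindex (onIndices w↭ₛv) {g = lookup v} (↭ₛ.onIndices-lookup (setoid A) w↭ₛv)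
    in v , v∈L , σ , trans (sym (tabulate-lookup w)) eq

  PERM⁻ : ∀ {L : Language A} {w} → PERM L w → ∃[ v ] (L v × w ↭ v)
  PERM⁻ (v , v∈L , σ , refl) =
    v , v∈L , ↭-trans (tabulate-permute σ (lookup v)) (↭-reflexive (tabulate-lookup v))

Pointwise-split : ∀ {A B : Set} {R : A → B → Set} xs {ys zs} → Pointwise R (xs ++ ys) zs →
                  ∃[ us ] ∃[ vs ] (zs ≡ us ++ vs × Pointwise R xs us × Pointwise R ys vs)
Pointwise-split []       rs       = _ , _ , refl , [] , rs
Pointwise-split (x ∷ xs) (r ∷ rs) with us , vs , refl , ps , qs ← Pointwise-split xs rs =
  _ ∷ us , vs , refl , r ∷ ps , qs

Pointwise-≢[] : ∀ {A B : Set} {R : A → B → Set} {xs ys} → Pointwise R xs ys → xs ≢ [] → ys ≢ []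
Pointwise-≢[] [] xs≢[] _ = xs≢[] refl
Pointwise-≢[] (_ ∷ _) _ ()

-- Derived rules from cyclic rotation.

rotate : ∀ {A} Γ Δ → Γ ++ Δ ⟶ A ↻ → Δ ++ Γ ⟶ A ↻
-- `cyc` accepts only nonempty blocks; when one is empty, both sequents agree up to `++-identityʳ`.
rotate {A} [] Δ d = subst (_⟶ A ↻) (sym (++-identityʳ Δ)) d
rotate {A} (C ∷ Γ) [] d = subst (_⟶ A ↻) (++-identityʳ (C ∷ Γ)) d
rotate (C ∷ Γ) (D ∷ Δ) d = cyc (C ∷ Γ) (D ∷ Δ) d

/-elim : ∀ {A B} Π → Π ≢ [] → Π ⟶ A → B / A ∷ Π ⟶ B
/-elim []      Π≢[] d = contradiction refl Π≢[]
/-elim (C ∷ Π) Π≢[] d =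
  subst (λ Δ → _ ∷ C ∷ Δ ⟶ _) (++-identityʳ Π) (/⟶ [] (C ∷ Π) [] Ax d)

/-insert : ∀ {A B} Γ Δ → Γ ++ Δ ≢ [] → Γ ++ Δ ⟶ A ↻ → Γ ++ [ B ↻ / A ↻ ] ++ Δ ⟶ B ↻
/-insert Γ Δ ≢[] d = rotate (_ ∷ Δ) Γ (/-elim (Δ ++ Γ) (≢[] ∘ swap-[] Δ) (rotate Γ Δ d))
  where
  swap-[] : ∀ Δ {Γ : List Tp} → Δ ++ Γ ≡ [] → Γ ++ Δ ≡ []
  swap-[] [] refl = refl

-- A commutative language model of the calculus.

module Semantics {A : Set} (I : Pr → Language A) where

  -- Closure under rearrangement is built into the clauses for `prim` and `_·_` and inherited by the
  -- others. Since order is immaterial, both divisions share one clause, with the argument word on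
  -- the left.
  ⟦_⟧ : Tp → Language A
  ⟦ prim k ⟧ w = ∃[ v ] (I k v × w ↭ v)
  ⟦ B ∖ C ⟧  w = ∀ {u} → ⟦ B ⟧ u → ⟦ C ⟧ (u ++ w)
  ⟦ C / B ⟧  w = ∀ {u} → ⟦ B ⟧ u → ⟦ C ⟧ (u ++ w)
  ⟦ B · C ⟧  w = ∃[ u ] ∃[ v ] (⟦ B ⟧ u × ⟦ C ⟧ v × w ↭ u ++ v)
  ⟦ B ↻ ⟧    w = ⟦ B ⟧ w

  -- Concatenation is exact here, so `split` yields equations; rearrangement enters `sound` only
  -- through `⟦_⟧-resp` on the succedent.
  data ⟦_⟧* : List Tp → Language A where
    []  : ⟦ [] ⟧* []
    _∷_ : ∀ {B Γ u v} → ⟦ B ⟧ u → ⟦ Γ ⟧* v → ⟦ B ∷ Γ ⟧* (u ++ v)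

  ⟦_⟧-resp : ∀ B {u v} → u ↭ v → ⟦ B ⟧ u → ⟦ B ⟧ v
  ⟦ prim k ⟧-resp u↭v (t , t∈I , u↭t)         = t , t∈I , ↭-trans (↭-sym u↭v) u↭t
  ⟦ B ∖ C ⟧-resp  u↭v f b                     = ⟦ C ⟧-resp (++⁺ˡ _ u↭v) (f b)
  ⟦ C / B ⟧-resp  u↭v f b                     = ⟦ C ⟧-resp (++⁺ˡ _ u↭v) (f b)
  ⟦ B · C ⟧-resp  u↭v (s , t , b , c , u↭s++t) = s , t , b , c , ↭-trans (↭-sym u↭v) u↭s++t
  ⟦ B ↻ ⟧-resp    u↭v b                       = ⟦ B ⟧-resp u↭v b

  join : ∀ {Γ Δ u v} → ⟦ Γ ⟧* u → ⟦ Δ ⟧* v → ⟦ Γ ++ Δ ⟧* (u ++ v)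
  join []                      δ = δ
  join (_∷_ {u = u} {v} b γ) δ = subst ⟦ _ ⟧* (sym (++-assoc u v _)) (b ∷ join γ δ)

  split : ∀ Γ {Δ w} → ⟦ Γ ++ Δ ⟧* w → ∃[ u ] ∃[ v ] (w ≡ u ++ v × ⟦ Γ ⟧* u × ⟦ Δ ⟧* v)
  split []      δ = [] , _ , refl , [] , δ
  split (B ∷ Γ) (_∷_ {u = t} b γδ) with u , v , refl , γ , δ ← split Γ γδ =
    t ++ u , v , sym (++-assoc t u v) , b ∷ γ , δ

  ⟦⟧*-single : ∀ {B u} → ⟦ B ⟧ u → ⟦ [ B ] ⟧* u
  ⟦⟧*-single b = subst ⟦ _ ⟧* (++-identityʳ _) (b ∷ [])

  sound : ∀ {Γ B w} → Γ ⟶ B → ⟦ Γ ⟧* w → ⟦ B ⟧ w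
  sound {B = B} Ax (_∷_ {u = u} b []) = subst ⟦ B ⟧ (sym (++-identityʳ u)) b
  sound {B = C} (∖⟶ Γ (P ∷ Π) Δ d e) s
    with g , _ , refl , γ , s₁ ← split Γ s
    with p , _ , refl , π , _∷_ {u = u} {t} f δ ← split (P ∷ Π) s₁ =
    ⟦ C ⟧-resp (++⁺ˡ g (↭-reflexive (++-assoc p u t))) (sound d (join γ (f (sound e π) ∷ δ)))
  sound {B = B ∖ C} (⟶∖ Π d) s b = sound d (b ∷ s)
  sound {B = C} (/⟶ Γ (P ∷ Π) Δ d e) s
    with g , _ , refl , γ , _∷_ {u = u} f s₁ ← split Γ s
    with p , t , refl , π , δ ← split (P ∷ Π) s₁ =
    -- The functor's word `u` precedes its argument's word `p`, but the clause for `_/_` produces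
    -- `p ++ u`; `shifts` exchanges them.
    ⟦ C ⟧-resp (++⁺ˡ g (↭-trans (↭-reflexive (++-assoc p u t)) (shifts p u)))
      (sound d (join γ (f (sound e π) ∷ δ)))
  sound {B = C / B} {w} (⟶/ Π d) s {u} b =
    ⟦ C ⟧-resp (++-comm w u) (sound d (join s (⟦⟧*-single b)))
  sound {B = C} (·⟶ Γ Δ d) s
    with g , _ , refl , γ , _∷_ {v = t} (u , v , a , b , q↭u++v) δ ← split Γ s =
    ⟦ C ⟧-resp
      (++⁺ˡ g (↭-trans (↭-reflexive (sym (++-assoc u v t))) (++⁺ʳ t (↭-sym q↭u++v))))
      (sound d (join γ (a ∷ b ∷ δ)))
  sound (⟶· (P ∷ Π) Ψ d e) s
    with p , q , refl , π , ψ ← split (P ∷ Π) s = p , q , sound d π , sound e ψ , ↭-refl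
  sound (cut Γ (P ∷ Π) Δ d e) s
    with g , _ , refl , γ , s₁ ← split Γ s
    with p , t , refl , π , δ ← split (P ∷ Π) s₁ = sound e (join γ (sound d π ∷ δ))
  sound (⟶↻ Π d) s = sound d s
  sound (↻⟶ d) (b ∷ []) = sound d (b ∷ [])
  sound {B = B} (cyc Π (Q ∷ Ψ) d) s
    with q , p , refl , ψ , π ← split (Q ∷ Ψ) s =
    ⟦ B ⟧-resp (++-comm p q) (sound d (join π ψ))

-- The grammar of an automaton.

module Automaton {A : Set} (fin : Finite A) (M : DFA A) where

  open DFA M

  run : List A → Fin states
  run = foldl δ start

  -- The successor keeps `0` free to stand for acceptance.
  code : Fin states → Pr
  code q = suc (toℕ q)

  codes : Fin states → List Pr
  codes q = code q ∷ (if accept q then [ 0 ] else [])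

  0∈codes⁺ : ∀ {q} → T (accept q) → 0 ∈ codes q
  0∈codes⁺ {q} acc with accept q
  ... | true = there (here refl)

  0∈codes⁻ : ∀ {q} → 0 ∈ codes q → T (accept q)
  0∈codes⁻ {q} (there 0∈) with accept q
  ... | true = _

  code∈codes⁻ : ∀ {p q} → code p ∈ codes q → p ≡ q
  code∈codes⁻     (here eq)  = toℕ-injective (suc-injective eq)
  code∈codes⁻ {q = q} (there c∈) with accept q
  code∈codes⁻ {q = q} (there (here ())) | true

  step : A → Fin states → List Tp
  step a q = map (λ k → prim k ↻ / prim (code q) ↻) (codes (δ q a))

  -- A letter that opens a run gets a type without division, because antecedents are nonempty and
  -- the empty prefix could not supply an argument.
  types : A → List Tp
  types a = map (λ k → prim k ↻) (codes (δ start a)) ++ concatMap (step a) (allFin states)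

  letters : List A
  letters = map (Inverse.from (proj₂ fin)) (allFin (proj₁ fin))

  ∈-letters : ∀ a → a ∈ letters
  ∈-letters a = subst (_∈ letters) (Inverse.strictlyInverseʳ (proj₂ fin) a)
    (∈-map⁺ _ (∈-allFin (Inverse.to (proj₂ fin) a)))

  G : Grammar A
  G = record
    { target  = prim 0 ↻
    ; lexicon = concatMap (λ a → map (a ,_) (types a)) letters
    }

  open Grammar G using (_▷_)

  ▷⁺ : ∀ {a B} → B ∈ types a → a ▷ B
  ▷⁺ {a} B∈ = ∈-concatMap⁺ _ (lose (∈-letters a) (∈-map⁺ _ B∈))

  ▷⁻ : ∀ {a B} → a ▷ B → B ∈ types a
  ▷⁻ a▷B with _ , _ , aB∈ ← find (∈-concatMap⁻ _ {xs = letters} a▷B)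
         with _ , B∈ , refl ← ∈-map⁻ _ aB∈ = B∈

  ▷-first : ∀ {a k} → k ∈ codes (δ start a) → a ▷ (prim k ↻)
  ▷-first k∈ = ▷⁺ (∈-++⁺ˡ (∈-map⁺ _ k∈))

  ▷-next : ∀ {a k} q → k ∈ codes (δ q a) → a ▷ (prim k ↻ / prim (code q) ↻)
  ▷-next {a} q k∈ = ▷⁺ (∈-++⁺ʳ _ (∈-concatMap⁺ (step a) (lose (∈-allFin q) (∈-map⁺ _ k∈))))

  codes-∷ʳ : ∀ {k a} v → k ∈ codes (run (v ∷ʳ a)) → k ∈ codes (δ (run v) a)
  codes-∷ʳ {k} {a} v = subst (λ q → k ∈ codes q) (foldl-∷ʳ δ start a v)

  Derivable : Pr → List A → Set
  Derivable k w = ∃[ Ts ] (Pointwise _▷_ w Ts × Ts ⟶ prim k ↻)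

  derivable-insert : ∀ v {a k} x y → x ++ y ↭ v → k ∈ codes (run (v ∷ʳ a)) →
                     (x ++ y ≢ [] → Derivable (code (run v)) (x ++ y)) →
                     Derivable k (x ++ [ a ] ++ y)
  derivable-insert [] x y xy↭[] k∈ _
    with refl ← ++-conicalˡ x y (↭-empty-inv xy↭[])
    with refl ← ↭-empty-inv xy↭[] = _ , ▷-first k∈ ∷ [] , Ax
  derivable-insert v@(c ∷ v′) x y xy↭v k∈ ih
    with xy≢[] ← ↭-resp-≢[] xy↭v (λ ())
    with Ts , ▷Ts , d ← ih xy≢[]
    with Γ , Δ , refl , ▷Γ , ▷Δ ← Pointwise-split x ▷Ts =
    _ , Pointwise.++⁺ ▷Γ (▷-next (run v) (codes-∷ʳ v k∈) ∷ ▷Δ) ,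
        /-insert Γ Δ (Pointwise-≢[] ▷Ts xy≢[]) d

  -- Induction on the last letter of the run, as `foldl` ends with it. The goal `k` stays general:
  -- the whole word aims at `0`, its prefixes at states.
  derivable : ∀ {v w k} → Reverse v → w ≢ [] → w ↭ v → k ∈ codes (run v) → Derivable k w
  derivable [] w≢[] w↭[] k∈ = contradiction (↭-empty-inv w↭[]) w≢[]
  derivable (v ∶ rs ∶ʳ a) w≢[] w↭va k∈ with x , y , refl , xy↭v ← ↭-∷ʳ-inv v w↭va =
    -- `here refl` selects the state code of the shorter run, which is the argument type that the
    -- inserted letter expects.
    derivable-insert v x y xy↭v k∈ λ xy≢[] → derivable rs xy≢[] xy↭v (here refl)

  -- `prim (code q)` thus denotes the rearrangements of words leading to `q`, and `prim 0` those of
  -- accepted words.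
  open Semantics (λ k v → k ∈ codes (run v))

  ▷⇒⟦⟧ : ∀ {a B} → a ▷ B → ⟦ B ⟧ [ a ]
  ▷⇒⟦⟧ {a} a▷B with ∈-++⁻ (map (λ k → prim k ↻) (codes (δ start a))) (▷⁻ a▷B)
  ... | inj₁ B∈ with k , k∈ , refl ← ∈-map⁻ _ B∈ = [ a ] , k∈ , ↭-refl
  ... | inj₂ B∈
    with q , _ , B∈′ ← find (∈-concatMap⁻ (step a) {xs = allFin states} B∈)
    -- The letter is appended to the witness `v`, whose run ends in `q` by `code∈codes⁻`; the run on
    -- the given word `u` itself may end elsewhere.
    with k , k∈ , refl ← ∈-map⁻ _ B∈′ = λ (v , c∈ , u↭v) →
      v ∷ʳ a ,
      subst (λ p → k ∈ codes p) (sym (foldl-∷ʳ δ start a v))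
        (subst (λ p → k ∈ codes (δ p a)) (code∈codes⁻ c∈) k∈) ,
      ++⁺ʳ [ a ] u↭v

  ▷⇒⟦⟧* : ∀ {w Ts} → Pointwise _▷_ w Ts → ⟦ Ts ⟧* w
  ▷⇒⟦⟧* []       = []
  ▷⇒⟦⟧* (r ∷ rs) = ▷⇒⟦⟧ r ∷ ▷⇒⟦⟧* rs

theorem5 : (A : Set) → Finite A → (L : Language A) → Regular L → ¬ L [] →
    Σ[ G ∈ Grammar A ] L⟨ G ⟩ ≐ PERM L
theorem5 A fin L (M , L⊆M , M⊆L) []∉L = G , recognized⇒permuted , permuted⇒recognized
  where
  open Automaton fin M
  open Semantics (λ k v → k ∈ codes (run v))

  recognized⇒permuted : ∀ {w} → L⟨ G ⟩ w → PERM L w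
  recognized⇒permuted (_ , _ , w▷Ts , d) =
    -- Membership in the meaning of the target is by definition an accepted word together with a
    -- rearrangement.
    let v , 0∈ , w↭v = sound d (▷⇒⟦⟧* w▷Ts) in PERM⁺ {L = L} (M⊆L (0∈codes⁻ 0∈)) w↭v

  permuted⇒recognized : ∀ {w} → PERM L w → L⟨ G ⟩ w
  permuted⇒recognized {w} w∈PERM with v , v∈L , w↭v ← PERM⁻ {L = L} w∈PERM =
    w≢[] , derivable (reverseView v) w≢[] w↭v (0∈codes⁺ (L⊆M v∈L))
    where
    w≢[] : w ≢ []
    w≢[] = ↭-resp-≢[] w↭v λ { refl → []∉L v∈L }
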